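{- For every positive integer $n$, $g(n) \le n^2-\left(2-\frac{1}{\sqrt{2}}\right)n+2$.
   Context: All graphs are finite and simple. An oriented graph is an orientation of a simple undirected graph; a tournament is an orientation of a complete graph. The chromatic number of an oriented graph is the chromatic number of its underlying undirected graph. An acyclic subgraph of an oriented graph is a subgraph containing no directed cycle. For an oriented graph $G$, $f(G)$ denotes the maximum chromatic number of an acyclic subgraph of $G$. For a positive integer $n$, $g(n)$ is the smallest integer such that every tournament $G$ with more than $g(n)$ vertices satisfies $f(G) > n$. -}

module Defs where

open import Data.Nat using (ℕ; suc; _*_)
open import Data.Integer using (ℤ; +_; _+_; _-_; _≤_; _<_)
  renaming (_*_ to _*ℤ_)
open import Data.Fin using (Fin; zero; fromℕ; inject₁) renaming (suc to fsuc)
open import Data.Bool using (Bool; true; false; T)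
open import Data.Product using (Σ; ∃; _×_)
open import Data.Sum using (_⊎_)
open import Data.Empty using (⊥)
open import Relation.Binary.PropositionalEquality using (_≡_; _≢_)
open import Relation.Nullary using (¬_)
open import Function.Definitions using (Injective)

ArcRel : ℕ → Set
ArcRel N = Fin N → Fin N → Bool

record IsTournament {N : ℕ} (A : ArcRel N) : Set where
  field
    irreflexive : ∀ i → A i i ≡ false
    total       : ∀ i j → i ≢ j → T (A i j) ⊎ T (A j i)
    asymmetric  : ∀ i j → T (A i j) → T (A j i) → ⊥

record Subgraph {N : ℕ} (A : ArcRel N) : Set where
  field
    V      : Fin N → Bool
    B      : ArcRel N
    B⊆A    : ∀ i j → T (B i j) → T (A i j)
    B-ends : ∀ i j → T (B i j) → T (V i) × T (V j)
open Subgraph public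

DirectedCycle : {N : ℕ} → ArcRel N → Set
DirectedCycle {N} B =
  Σ ℕ λ k → Σ (Fin (suc (suc k)) → Fin N) λ c →
    Injective _≡_ _≡_ c
    × (∀ (i : Fin (suc k)) → T (B (c (inject₁ i)) (c (fsuc i))))
    × T (B (c (fromℕ (suc k))) (c zero))

Acyclic : {N : ℕ} {A : ArcRel N} → Subgraph A → Set
Acyclic H = ¬ DirectedCycle (B H)

Colourable : ℕ → {N : ℕ} {A : ArcRel N} → Subgraph A → Set
Colourable n {N} H =
  Σ ((i : Fin N) → T (V H i) → Fin n) λ col →
    ∀ i j (b : T (B H i j)) →
      col i (Data.Product.proj₁ (B-ends H i j b))
        ≢ col j (Data.Product.proj₂ (B-ends H i j b))

ChromaticGt : {N : ℕ} {A : ArcRel N} → Subgraph A → ℕ → Set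
ChromaticGt H n = ¬ Colourable n H

fGt : {N : ℕ} → ArcRel N → ℕ → Set
fGt A n = Σ (Subgraph A) λ H → Acyclic H × ChromaticGt H n

-- The defining property of g(n): m satisfies it iff every tournament
-- with more than m vertices has f > n.  g(n) is the least such m.
GProperty : ℕ → ℕ → Set
GProperty n m = ∀ N → m Data.Nat.< N → (A : ArcRel N) → IsTournament A → fGt A n

-- For natural numbers n, m:
--   m ≤ n² − (2 − 1/√2) n + 2
--   ⇔ d ≤ n/√2  where d = m + 2n − n² − 2 ∈ ℤ
--   ⇔ d ≤ 0  or  2 d² ≤ n².
BelowBound : ℕ → ℕ → Set
BelowBound n m = (d ≤ + 0) ⊎ (+ 2 *ℤ (d *ℤ d) ≤ + (n * n))
  where
  d : ℤ
  d = + m + + (2 * n) - + (n * n) - + 2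

{-# OPTIONS --safe #-}
module Submission where

open import Defs
open import Data.Nat using (ℕ; zero; suc; _+_; _*_; _≤_; _<_; _<ᵇ_; _≤?_; z≤n; s≤s)
open import Data.Nat.Properties hiding (_≟_)
open import Data.Nat.Tactic.RingSolver using (solve-∀)
open import Data.Bool using (Bool; true; false; T; _∧_; if_then_else_)
open import Data.Bool.Properties using (T?; T-∧)
open import Data.Fin using (Fin; zero; suc; inject₁; fromℕ; punchIn; punchOut; _≟_)
open import Data.Fin.Properties using (any?; punchIn-punchOut)
open import Data.List using (List; []; _∷_; [_]; _++_; length; filter; reverse; take; drop; allFin; tabulate)
open import Data.List.Properties using (filter-++; filter-none; filter-all; filter-reject; unfold-reverse; length-take; length-++; take++drop≡id; length-tabulate)
open import Data.List.Membership.Propositional using (_∈_; find; lose)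
open import Data.List.Membership.Propositional.Properties using (∈-∃++; ∈-filter⁺; ∈-allFin)
open import Data.List.Relation.Unary.All as All using (All; []; _∷_)
import Data.List.Relation.Unary.All.Properties as All
import Data.List.Relation.Binary.Permutation.Setoid.Properties as Permutationₛ
open import Data.List.Relation.Unary.Any as Any using (here; there)
open import Data.List.Relation.Unary.AllPairs as AllPairs using (AllPairs; []; _∷_)
import Data.List.Relation.Unary.AllPairs.Properties as AllPairs
open import Data.List.Relation.Unary.Unique.Propositional using (Unique)
open import Data.List.Relation.Unary.Unique.Propositional.Properties using (allFin⁺)
open import Data.List.Relation.Binary.Permutation.Propositional using (_↭_; prep; ↭⇒↭ₛ; ↭-refl; ↭-sym; ↭-trans; ↭-reflexive; module PermutationReasoning)
open import Data.List.Relation.Binary.Permutation.Propositional.Properties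
open import Data.Product using (Σ; ∃; ∃₂; _×_; _,_; proj₁; proj₂)
open import Data.Sum using (inj₁; inj₂)
open import Data.Empty using (⊥)
open import Data.Unit using (tt)
open import Function using (flip; _∘_; Equivalence)
open import Level using (0ℓ)
open import Relation.Binary using (Rel)
open import Relation.Binary.PropositionalEquality hiding ([_])
open import Relation.Nullary using (Dec; yes; no; ¬_; does; contradiction)
open import Relation.Nullary.Decidable using (_×-dec_; ¬?)
open import Relation.Unary using (Pred; Decidable)
open import Data.Integer as ℤ using (ℤ; +≤+) renaming (+_ to pos)
import Data.Integer.Properties as ℤ
import Data.Integer.Tactic.RingSolver as ℤ
open import Algebra.Properties.Semiring.Sum +-*-semiring
  using (sum; sum-cong-≗; sum-remove; ∑-distrib-+; ∑-comm; *-distribˡ-sum; *-distribʳ-sum)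

-- A list of vertices gives an acyclic subgraph F, its forward arcs.  A colour class of F is a
-- backward clique, so it is transitive, and we may assume that it has at most n vertices:
-- a transitive subtournament on n + 1 vertices already has chromatic number n + 1.
--
-- Counting cyclic triangles, some arc u → v lies in at most (N + 1)/4 of them; let C be the set
-- of their third vertices.  Every vertex outside C ∪ {u, v} can be put before u, between u and v,
-- or after v so that its arcs to u and v go forward.  With C at the end, the class of v is {v}
-- and the class of u is u together with a backward clique of C.  Repeatedly moving a transitive
-- set of C to the front of the remaining list, in forward order, bounds the backward cliques
-- of C by about √(2|C|) ≤ n/√2.  If n colours suffice, then N ≤ n(n − 2) + 2 + n/√2.

-- Lists: pairwise relations, permutations and filters.

module _ {X : Set} {R : Rel X 0ℓ} where

  AllPairs-++⁻ : ∀ xs {ys} → AllPairs R (xs ++ ys) →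
                 AllPairs R xs × All (λ x → All (R x) ys) xs × AllPairs R ys
  AllPairs-++⁻ []       ps       = [] , [] , ps
  AllPairs-++⁻ (x ∷ xs) (p ∷ ps) with AllPairs-++⁻ xs ps
  ... | l , m , r = All.++⁻ˡ xs p ∷ l , All.++⁻ʳ xs p ∷ m , r

  AllPairs-reverse : ∀ {xs} → AllPairs R xs → AllPairs (flip R) (reverse xs)
  AllPairs-reverse []                 = []
  AllPairs-reverse {x ∷ xs} (p ∷ ps) =
    subst (AllPairs _) (sym (unfold-reverse x xs))
      (AllPairs.++⁺ (AllPairs-reverse ps) ([] ∷ [])
                    (All.map (λ r → r ∷ []) (All-resp-↭ (↭-sym (↭-reverse xs)) p)))

  AllPairs-restrict : ∀ {P : Pred X 0ℓ} {xs} → All P xs → AllPairs R xs →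
                      AllPairs (λ x y → P x × P y × R x y) xs
  AllPairs-restrict []       []       = []
  AllPairs-restrict (q ∷ qs) (p ∷ ps) =
    All.zipWith (λ (a , b) → q , a , b) (qs , p) ∷ AllPairs-restrict qs ps

  -- The first two entries would satisfy both relations in the same order. This serves for a chain
  -- meeting a backward clique and for a colour class of a chain.
  length≤1 : ∀ {Q : Rel X 0ℓ} {xs} → (∀ {x y} → R x y → Q x y → ⊥) →
             AllPairs R xs → AllPairs Q xs → length xs ≤ 1
  length≤1 clash []                  _                   = z≤n
  length≤1 clash (_ ∷ [])            _                   = s≤s z≤n
  length≤1 clash ((r ∷ _) ∷ _ ∷ _) ((q ∷ _) ∷ _ ∷ _) = contradiction q (clash r)

module _ {X : Set} where

  ↭-filter-split : ∀ {P : Pred X 0ℓ} (P? : Decidable P) xs →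
                   xs ↭ filter P? xs ++ filter (¬? ∘ P?) xs
  ↭-filter-split P? []       = ↭-refl
  ↭-filter-split P? (x ∷ xs) with P? x
  ... | yes _ = prep x (↭-filter-split P? xs)
  ... | no  _ = ↭-trans (prep x (↭-filter-split P? xs)) (↭-sym (shift x (filter P? xs) _))

  Unique-resp-↭ : ∀ {xs ys : List X} → xs ↭ ys → Unique xs → Unique ys
  Unique-resp-↭ = Permutationₛ.Unique-resp-↭ (setoid X) ∘ ↭⇒↭ₛ

  ∈⇒↭ : ∀ {x : X} {xs} → x ∈ xs → ∃ λ ys → xs ↭ x ∷ ys
  ∈⇒↭ {x} x∈xs with ∈-∃++ x∈xs
  ... | ys , zs , refl = ys ++ zs , shift x ys zs

  interleave : ∀ (u v : X) C D M O → C ++ u ∷ v ∷ D ++ M ++ O ↭ D ++ u ∷ M ++ v ∷ O ++ C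
  interleave u v C D M O = begin
    C ++ u ∷ v ∷ D ++ M ++ O     ↭⟨ ++-comm C _ ⟩
    u ∷ v ∷ (D ++ M ++ O) ++ C   ↭⟨ prep u (prep v (↭-trans (++-assoc D (M ++ O) C) (++⁺ˡ D (++-assoc M O C)))) ⟩
    u ∷ v ∷ D ++ M ++ O ++ C     ↭⟨ prep u (shift v D (M ++ O ++ C)) ⟨
    u ∷ D ++ v ∷ M ++ O ++ C     ↭⟨ prep u (++⁺ˡ D (shift v M (O ++ C))) ⟨
    u ∷ D ++ M ++ v ∷ O ++ C     ↭⟨ shift u D _ ⟨
    D ++ u ∷ M ++ v ∷ O ++ C     ∎
    where open PermutationReasoning

  filter-skip : ∀ {P : Pred X 0ℓ} (P? : Decidable P) {xs} ys → All (¬_ ∘ P) xs →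
                filter P? (xs ++ ys) ≡ filter P? ys
  filter-skip P? {xs} ys ¬P = trans (filter-++ P? xs ys) (cong (_++ filter P? ys) (filter-none P? ¬P))

  length-filter-∷ : ∀ {P : Pred X 0ℓ} (P? : Decidable P) x xs →
                    length (filter P? (x ∷ xs)) ≤ suc (length (filter P? xs))
  length-filter-∷ P? x xs with does (P? x)
  ... | true  = ≤-refl
  ... | false = n≤1+n _

-- Finite sums and colour classes.

sum-mono : ∀ {n} {f g : Fin n → ℕ} → (∀ i → f i ≤ g i) → sum f ≤ sum g
sum-mono {zero}  f≤g = z≤n
sum-mono {suc n} f≤g = +-mono-≤ (f≤g zero) (sum-mono (f≤g ∘ suc))

sum-const : ∀ n b → sum {n} (λ _ → b) ≡ n * b
sum-const zero    b = refl
sum-const (suc n) b = cong (b +_) (sum-const n b)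

𝟙 : Bool → ℕ
𝟙 b = if b then 1 else 0

sum-δ : ∀ {n} (i : Fin n) (f : Fin n → ℕ) → sum (λ j → 𝟙 (does (i ≟ j)) * f j) ≡ f i
sum-δ {suc n} zero    f =
  trans (cong₂ _+_ (+-identityʳ (f zero)) (trans (sum-const n 0) (*-zeroʳ n))) (+-identityʳ _)
sum-δ {suc n} (suc i) f = sum-δ i (f ∘ suc)

sum-*-sum : ∀ {m n} (f : Fin m → ℕ) (g : Fin n → ℕ) →
            sum f * sum g ≡ sum (λ i → sum (λ j → f i * g j))
sum-*-sum f g = trans (*-distribʳ-sum (sum g) f) (sum-cong-≗ (λ i → *-distribˡ-sum (f i) g))

length-filter-tabulate : ∀ {n} {X : Set} {P : Pred X 0ℓ} (P? : Decidable P) (g : Fin n → X) →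
                         length (filter P? (tabulate g)) ≡ sum (λ i → 𝟙 (does (P? (g i))))
length-filter-tabulate {zero}  P? g = refl
length-filter-tabulate {suc n} P? g with does (P? (g zero))
... | true  = cong suc (length-filter-tabulate P? (g ∘ suc))
... | false = length-filter-tabulate P? (g ∘ suc)

module _ {X : Set} {n} (c : X → Fin n) where

  class : Fin n → List X → List X
  class k = filter (λ x → c x ≟ k)

  length-classes : ∀ xs → length xs ≡ sum (λ k → length (class k xs))
  length-classes []       = sym (trans (sum-const n 0) (*-zeroʳ n))
  length-classes (x ∷ xs) = begin
    suc (length xs)
      ≡⟨ cong₂ _+_ (sym (sum-δ (c x) (λ _ → 1))) (length-classes xs) ⟩
    sum (λ k → 𝟙 (does (c x ≟ k)) * 1) + sum (λ k → length (class k xs))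
      ≡⟨ sym (∑-distrib-+ (λ k → 𝟙 (does (c x ≟ k)) * 1) _) ⟩
    sum (λ k → 𝟙 (does (c x ≟ k)) * 1 + length (class k xs))
      ≡⟨ sum-cong-≗ step ⟩
    sum (λ k → length (class k (x ∷ xs))) ∎
    where
    open ≡-Reasoning
    step : ∀ k → 𝟙 (does (c x ≟ k)) * 1 + length (class k xs) ≡ length (class k (x ∷ xs))
    step k with does (c x ≟ k)
    ... | true  = refl
    ... | false = refl

sum-bound : ∀ {n} {f : Fin n → ℕ} {b} → (∀ i → f i ≤ b) → sum f ≤ n * b
sum-bound {n} {b = b} f≤b = ≤-trans (sum-mono f≤b) (≤-reflexive (sum-const n b))

-- The two exceptional indices will be the colours of `u` and `v`.
sum-bound₂ : ∀ {j b p q} {f : Fin (suc (suc j)) → ℕ} (i₁ i₂ : Fin (suc (suc j))) → i₁ ≢ i₂ →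
             f i₁ ≤ p → f i₂ ≤ q → (∀ i → f i ≤ b) → sum f ≤ p + (q + j * b)
sum-bound₂ {j} {b} {p} {q} {f} i₁ i₂ i₁≢i₂ f₁ f₂ f≤b = begin
  sum f                                  ≡⟨ sum-remove {i = i₁} f ⟩
  f i₁ + sum g                           ≡⟨ cong (f i₁ +_) (sum-remove {i = i₂′} g) ⟩
  f i₁ + (g i₂′ + sum (g ∘ punchIn i₂′)) ≤⟨ +-mono-≤ f₁ (+-mono-≤ g₂ (sum-bound {j} {g ∘ punchIn i₂′} (λ i → f≤b _))) ⟩
  p + (q + j * b)                        ∎
  where
  open ≤-Reasoning
  g = f ∘ punchIn i₁
  i₂′ = punchOut i₁≢i₂
  g₂ : g i₂′ ≤ q
  g₂ = subst (λ i → f i ≤ q) (sym (punchIn-punchOut i₁≢i₂)) f₂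

-- The difference of the two sides is the square of `x - y`; writing the larger number as the
-- smaller plus `d` avoids truncated subtraction.
4xy≤[x+y]² : ∀ x y → 4 * (x * y) ≤ (x + y) * (x + y)
4xy≤[x+y]² x y with ≤-total x y
... | inj₁ x≤y with m≤n⇒∃[o]m+o≡n x≤y
...   | d , refl = subst (4 * (x * (x + d)) ≤_) (square x d) (m≤m+n _ (d * d))
  where
  square : ∀ x d → 4 * (x * (x + d)) + d * d ≡ (x + (x + d)) * (x + (x + d))
  square = solve-∀
4xy≤[x+y]² x y | inj₂ y≤x with m≤n⇒∃[o]m+o≡n y≤x
...   | d , refl = subst (4 * ((y + d) * y) ≤_) (square y d) (m≤m+n _ (d * d))
  where
  square : ∀ y d → 4 * ((y + d) * y) + d * d ≡ (y + d + y) * (y + d + y)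
  square = solve-∀

-- Subgraphs of arcs going forward in a linear order

module _ {N : ℕ} where

  position : List (Fin N) → Fin N → ℕ
  -- By this default an unlisted vertex gets the length of the list as its position, so it comes
  -- after every listed one.
  position []       y = 0
  position (x ∷ xs) y = if does (x ≟ y) then 0 else suc (position xs y)

  position-head : ∀ x xs → position (x ∷ xs) x ≡ 0
  position-head x xs with x ≟ x
  ... | yes _   = refl
  ... | no x≢x = contradiction refl x≢x

  position-tail : ∀ {x y} xs → x ≢ y → position (x ∷ xs) y ≡ suc (position xs y)
  position-tail {x} {y} xs x≢y with x ≟ y
  ... | yes x≡y = contradiction x≡y x≢y
  ... | no _    = refl

  position-increasing : ∀ {xs} → Unique xs → AllPairs (λ x y → position xs x < position xs y) xs
  position-increasing []                = []
  position-increasing {x ∷ xs} (u ∷ us) =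
    All.map (λ x≢y → subst₂ _<_ (sym (position-head x xs)) (sym (position-tail xs x≢y)) (s≤s z≤n)) u
    ∷ AllPairs.map (λ (x≢y , x≢z , y<z) →
                      subst₂ _<_ (sym (position-tail xs x≢y)) (sym (position-tail xs x≢z)) (s≤s y<z))
                   (AllPairs-restrict u (position-increasing us))

increasing⇒zero≤last : ∀ k (f : Fin (suc k) → ℕ) → (∀ i → f (inject₁ i) < f (suc i)) →
                       f zero ≤ f (fromℕ k)
increasing⇒zero≤last zero    f inc = ≤-refl
increasing⇒zero≤last (suc k) f inc =
  ≤-trans (<⇒≤ (inc zero)) (increasing⇒zero≤last k (f ∘ suc) (inc ∘ suc))

module _ {N : ℕ} (A : ArcRel N) where

  -- Properness for the subgraph of arcs going forward in the list. Backward arcs impose nothing,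
  -- which is why colour classes are backward cliques.
  Proper : ∀ {n} → (Fin N → Fin n) → List (Fin N) → Set
  Proper c = AllPairs (λ x y → T (A x y) → c x ≢ c y)

  forward : (Fin N → ℕ) → Subgraph A
  forward r = record
    { V      = λ _ → true
    ; B      = λ i j → A i j ∧ (r i <ᵇ r j)
    ; B⊆A    = λ i j → proj₁ ∘ Equivalence.to T-∧
    ; B-ends = λ _ _ _ → tt , tt
    }

  -- Ranks rise along every arc, so the first vertex of a cycle ranks no higher than the last, while
  -- the closing arc demands that it rank higher.
  forward-acyclic : ∀ r → Acyclic (forward r)
  forward-acyclic r (k , cyc , _ , arcs , back) =
    <⇒≱ (increases back) (increasing⇒zero≤last (suc k) (r ∘ cyc) (increases ∘ arcs))
    where
    increases : ∀ {i j} → T (A i j ∧ (r i <ᵇ r j)) → r i < r j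
    increases {i} b = <ᵇ⇒< (r i) _ (proj₂ (Equivalence.to (T-∧ {A i _}) b))

  -- Ranking by position makes every forward arc of the list an arc of the subgraph. Unlisted
  -- vertices only add arcs, so a colouring of the subgraph still restricts to the list.
  order⇒fGt : ∀ {n} xs → Unique xs → (∀ (c : Fin N → Fin n) → ¬ Proper c xs) → fGt A n
  order⇒fGt xs unique ¬proper = forward r , forward-acyclic r , λ (col , proper) →
    ¬proper (λ i → col i tt)
      (AllPairs.map (λ {x} {y} x<y xy → proper x y (Equivalence.from T-∧ (xy , <⇒<ᵇ x<y)))
                    (position-increasing unique))
    where
    r = position xs

module _ {N : ℕ} (A : ArcRel N) (tournament : IsTournament A) where
  open IsTournament tournament

  Arc : Rel (Fin N) 0ℓ
  Arc x y = T (A x y)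

  ¬loop : ∀ {x} → ¬ Arc x x
  ¬loop {x} = subst T (irreflexive x)

  reversed : ∀ {x y} → x ≢ y → ¬ Arc x y → Arc y x
  reversed {x} {y} x≢y ¬xy with total x y x≢y
  ... | inj₁ xy = contradiction xy ¬xy
  ... | inj₂ yx = yx

  -- Transitive subtournaments

  -- A transitive subtournament with its vertices in forward order. The remainder `R` is kept
  -- because `reorder` recurses on it.
  HasChain : ℕ → List (Fin N) → Set
  HasChain k L = ∃₂ λ X R → L ↭ X ++ R × AllPairs Arc X × length X ≡ k

  out? : ∀ x → Decidable (Arc x)
  out? x y = T? (A x y)

  extend-chain : ∀ {k L x} → x ∈ L → HasChain k (filter (out? x) L) → HasChain (suc k) L
  extend-chain {k} {L} {x} x∈L (X , R , L⁺↭ , chain , len)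
    -- `x` is not its own out-neighbour, so it survives in the complementary filter and can be moved
    -- from there to the head of the chain.
    with ∈⇒↭ (∈-filter⁺ (¬? ∘ out? x) x∈L ¬loop)
  ... | R′ , L⁻↭ = x ∷ X , R ++ R′ , perm
                 , All.++⁻ˡ X (All-resp-↭ L⁺↭ (All.all-filter (out? x) L)) ∷ chain
                 , cong suc len
    where
    perm : L ↭ x ∷ X ++ R ++ R′
    perm = ↭-trans (↭-filter-split (out? x) L)
          (↭-trans (++⁺ L⁺↭ L⁻↭)
          (↭-trans (shift x (X ++ R) R′)
                   (prep x (++-assoc X R R′))))

  shorten-chain : ∀ {k L} → HasChain (suc k) L → ∃ λ x → x ∈ L × HasChain k (filter (out? x) L)
  shorten-chain {L = L} (x ∷ X , R , L↭ , p ∷ chain , refl) =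
    x , ∈-resp-↭ (↭-sym L↭) (here refl) , X , filter (out? x) R , perm , chain , refl
    where
    perm : filter (out? x) L ↭ X ++ filter (out? x) R
    perm = ↭-trans (filter-↭ (out? x) L↭)
      (↭-reflexive (trans (filter-reject (out? x) ¬loop)
      (trans (filter-++ (out? x) X R) (cong (_++ filter (out? x) R) (filter-all (out? x) p)))))

  -- A nonempty chain is a vertex followed by a chain among its out-neighbours, so a search over `L`
  -- decides by recursion on `k`. The case splits of `reorder` and `tournament⇒fGt` rest on this.
  hasChain? : ∀ k L → Dec (HasChain k L)
  hasChain? zero    L = yes ([] , L , ↭-refl , [] , refl)
  hasChain? (suc k) L with Any.any? (λ x → hasChain? k (filter (out? x) L)) L
  ... | yes some = let _ , x∈L , chain = find some in yes (extend-chain x∈L chain)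
  ... | no  none = no λ chain → let _ , x∈L , chain′ = shorten-chain chain in
                                none (lose x∈L chain′)

  -- Reversal turns a backward clique into a chain; `take k` then cuts it to the exact length.
  backward⇒chain : ∀ {k L} {P : Pred (Fin N) 0ℓ} (P? : Decidable P) →
                   AllPairs (flip Arc) (filter P? L) → k ≤ length (filter P? L) → HasChain k L
  backward⇒chain {k} {L} P? backward k≤ =
      take k Y , drop k Y ++ Z′ , perm , AllPairs.take⁺ k (AllPairs-reverse backward)
    , trans (length-take k Y) (m≤n⇒m⊓n≡m (subst (k ≤_) (sym (↭-length (↭-reverse Z))) k≤))
    where
    Z  = filter P? L
    Z′ = filter (¬? ∘ P?) L
    Y  = reverse Z
    perm : L ↭ take k Y ++ drop k Y ++ Z′
    perm = ↭-trans (↭-filter-split P? L)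
          (↭-trans (++⁺ʳ Z′ (↭-sym (↭-reverse Z)))
          (↭-trans (↭-reflexive (cong (_++ Z′) (sym (take++drop≡id k Y))))
                   (++-assoc (take k Y) _ _)))

  -- Cliques are given as filters because colour classes are filters and filters distribute over
  -- `++`.
  Short : ℕ → List (Fin N) → Set₁
  Short s xs = ∀ {P : Pred (Fin N) 0ℓ} (P? : Decidable P) →
               AllPairs (flip Arc) (filter P? xs) → length (filter P? xs) < s

  -- A backward clique meets a chain placed in forward order at most once,
  -- so removing a chain of s vertices lowers the bound on backward cliques by one.
  reorder : ∀ s L → 2 * length L < s * suc s →
            ∃ λ L′ → L ↭ L′ × Short s L′
  reorder (suc s) L small with hasChain? (suc s) L
  -- With no chain of `suc s` vertices the given order already works: a backward clique of that size
  -- would reverse to such a chain.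
  ... | no ¬chain = L , ↭-refl , λ P? backward → ≰⇒> (¬chain ∘ backward⇒chain P? backward)
  ... | yes (X , R , L↭ , chain , len) with reorder s R smaller
    where
    smaller : 2 * length R < s * suc s
    -- The threshold `s * suc s` is chosen so that consecutive values differ by exactly twice the
    -- length of the removed chain.
    smaller = +-cancelˡ-< (2 * suc s) _ _ (subst₂ _<_
      (trans (cong (2 *_) (trans (↭-length L↭) (trans (length-++ X) (cong (_+ length R) len))))
             (*-distribˡ-+ 2 (suc s) (length R)))
      (solve s) small)
      where
      solve : ∀ s → suc s * suc (suc s) ≡ 2 * suc s + s * suc s
      solve = solve-∀
  ... | R′ , R↭ , short = X ++ R′ , ↭-trans L↭ (++⁺ˡ X R↭) , bound
    where
    bound : Short (suc s) (X ++ R′)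
    bound P? backward rewrite filter-++ P? X R′ | length-++ (filter P? X) {filter P? R′}
      with AllPairs-++⁻ (filter P? X) backward
    ... | backX , _ , backR =
      s≤s (≤-trans (+-monoˡ-≤ _ (length≤1 (asymmetric _ _) (AllPairs.filter⁺ P? chain) backX))
                   (short P? backR))

  -- Equal colours exclude a forward arc, so totality supplies the backward one; uniqueness gives
  -- the distinctness that totality asks for.
  class-backward : ∀ {n} {c : Fin N → Fin n} k {xs} → Proper A c xs → Unique xs →
                   AllPairs (flip Arc) (class c k xs)
  class-backward {c = c} k {xs} proper unique =
    AllPairs.map (λ (cx , cy , xy⇒ , x≢y) → reversed x≢y (λ xy → xy⇒ xy (trans cx (sym cy))))
      (AllPairs-restrict (All.all-filter _ xs) (AllPairs.filter⁺ _ (AllPairs.zip (proper , unique))))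

  -- Counting cyclic triangles

  a : Fin N → Fin N → ℕ
  a i j = 𝟙 (A i j)

  δ : Fin N → Fin N → ℕ
  δ i j = 𝟙 (does (i ≟ j))

  a+a+δ≡1 : ∀ i j → a i j + a j i + δ i j ≡ 1
  a+a+δ≡1 i j with i ≟ j
  ... | yes refl rewrite irreflexive i = refl
  ... | no i≢j with A i j | A j i | total i j i≢j | asymmetric i j
  ...   | true  | true  | _      | asym = contradiction tt (asym tt)
  ...   | true  | false | _      | _    = refl
  ...   | false | true  | _      | _    = refl
  ...   | false | false | inj₁ () | _
  ...   | false | false | inj₂ () | _

  a*a≡0 : ∀ i j → a i j * a j i ≡ 0
  a*a≡0 i j with A i j | A j i | asymmetric i j
  ... | true  | true  | asym = contradiction tt (asym tt)
  ... | true  | false | _    = refl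
  ... | false | _     | _    = refl

  a*a≡a : ∀ i j → a i j * a i j ≡ a i j
  a*a≡a i j with A i j
  ... | true  = refl
  ... | false = refl

  ∑∑ : (Fin N → Fin N → ℕ) → ℕ
  ∑∑ f = sum (λ i → sum (f i))

  ∑∑-cong : ∀ {f g} → (∀ i j → f i j ≡ g i j) → ∑∑ f ≡ ∑∑ g
  ∑∑-cong f≡g = sum-cong-≗ (λ i → sum-cong-≗ (f≡g i))

  ∑∑-distrib-+ : ∀ f g → ∑∑ (λ i j → f i j + g i j) ≡ ∑∑ f + ∑∑ g
  ∑∑-distrib-+ f g = trans (sum-cong-≗ (λ i → ∑-distrib-+ (f i) (g i))) (∑-distrib-+ (sum ∘ f) (sum ∘ g))

  -- By `a+a+δ≡1`, each ordered pair is exactly one of an arc, a reversed arc or a diagonal pair.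
  ∑∑-split : ∀ (P : Fin N → Fin N → ℕ) →
             ∑∑ P ≡ ∑∑ (λ i j → P i j * a i j) + ∑∑ (λ i j → P i j * a j i) + sum (λ i → P i i)
  ∑∑-split P = begin
    ∑∑ P
      ≡⟨ ∑∑-cong (λ i j → trans (sym (*-identityʳ (P i j)))
                         (trans (cong (P i j *_) (sym (a+a+δ≡1 i j))) (expand (P i j) _ _ _))) ⟩
    ∑∑ (λ i j → P i j * a i j + P i j * a j i + δ i j * P i j)
      ≡⟨ ∑∑-distrib-+ (λ i j → P i j * a i j + P i j * a j i) (λ i j → δ i j * P i j) ⟩
    ∑∑ (λ i j → P i j * a i j + P i j * a j i) + ∑∑ (λ i j → δ i j * P i j)
      ≡⟨ cong₂ _+_ (∑∑-distrib-+ (λ i j → P i j * a i j) (λ i j → P i j * a j i))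
                   (sum-cong-≗ (λ i → sum-δ i (P i))) ⟩
    ∑∑ (λ i j → P i j * a i j) + ∑∑ (λ i j → P i j * a j i) + sum (λ i → P i i) ∎
    where
    open ≡-Reasoning
    expand : ∀ p x y z → p * (x + y + z) ≡ p * x + p * y + z * p
    expand = solve-∀

  outdegree indegree : Fin N → ℕ
  outdegree v = sum (a v)
  indegree  v = sum (λ u → a u v)

  arcs : ℕ
  arcs = sum outdegree

  degree : ∀ v → suc (outdegree v + indegree v) ≡ N
  degree v = begin
    suc (outdegree v + indegree v)
      ≡⟨ sym (+-comm (outdegree v + indegree v) 1) ⟩
    outdegree v + indegree v + 1
      ≡⟨ sym (cong₂ _+_ (∑-distrib-+ (a v) (λ u → a u v)) (sum-δ v (λ _ → 1))) ⟩
    sum (λ u → a v u + a u v) + sum (λ u → δ v u * 1)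
      ≡⟨ sym (∑-distrib-+ (λ u → a v u + a u v) (λ u → δ v u * 1)) ⟩
    sum (λ u → a v u + a u v + δ v u * 1)
      ≡⟨ sum-cong-≗ (λ u → trans (cong (a v u + a u v +_) (*-identityʳ (δ v u))) (a+a+δ≡1 v u)) ⟩
    sum {N} (λ _ → 1)
      ≡⟨ trans (sum-const N 1) (*-identityʳ N) ⟩
    N ∎
    where open ≡-Reasoning

  -- Ordered triples u → v → w with w → u, respectively with u → w.
  cyclic transitive : ℕ
  cyclic     = sum (λ v → ∑∑ (λ u w → a u v * a v w * a w u))
  transitive = sum (λ v → ∑∑ (λ u w → a u v * a v w * a u w))

  -- Both sides count the paths u → v → w, the left by middle vertex, the right by the direction of
  -- the arc between the ends. The case u = w vanishes by asymmetry.
  ∑indegree*outdegree : sum (λ v → indegree v * outdegree v) ≡ transitive + cyclic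
  ∑indegree*outdegree = trans (sum-cong-≗ at)
    (∑-distrib-+ (λ v → ∑∑ (λ u w → a u v * a v w * a u w)) (λ v → ∑∑ (λ u w → a u v * a v w * a w u)))
    where
    open ≡-Reasoning
    at : ∀ v → indegree v * outdegree v ≡
               ∑∑ (λ u w → a u v * a v w * a u w) + ∑∑ (λ u w → a u v * a v w * a w u)
    at v = begin
      indegree v * outdegree v
        ≡⟨ sum-*-sum (λ u → a u v) (a v) ⟩
      ∑∑ (λ u w → a u v * a v w)
        ≡⟨ ∑∑-split (λ u w → a u v * a v w) ⟩
      T₁ + sum (λ u → a u v * a v u)
        ≡⟨ cong (T₁ +_) (trans (sum-cong-≗ (λ u → a*a≡0 u v)) (trans (sum-const N 0) (*-zeroʳ N))) ⟩
      T₁ + 0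
        ≡⟨ +-identityʳ T₁ ⟩
      T₁ ∎
      where
      T₁ = ∑∑ (λ u w → a u v * a v w * a u w) + ∑∑ (λ u w → a u v * a v w * a w u)

  -- The left side counts ordered pairs of arcs leaving `u`. Heads v and w that differ give a
  -- transitive triple for either direction of the arc between them; equal heads give `arcs`.
  ∑outdegree² : sum (λ u → outdegree u * outdegree u) ≡ transitive + transitive + arcs
  ∑outdegree² = begin
    sum (λ u → outdegree u * outdegree u)
      ≡⟨ sum-cong-≗ at ⟩
    sum (λ u → T₁ u + T₁ u + outdegree u)
      ≡⟨ ∑-distrib-+ (λ u → T₁ u + T₁ u) outdegree ⟩
    sum (λ u → T₁ u + T₁ u) + arcs
      ≡⟨ cong (_+ arcs) (∑-distrib-+ T₁ T₁) ⟩
    sum T₁ + sum T₁ + arcs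
      ≡⟨ cong (λ t → t + t + arcs) ∑T₁ ⟩
    transitive + transitive + arcs ∎
    where
    open ≡-Reasoning
    swap₂₃ : ∀ x y z → x * y * z ≡ x * z * y
    swap₂₃ = solve-∀
    T₁ : Fin N → ℕ
    T₁ u = ∑∑ (λ v w → a u v * a u w * a v w)
    at : ∀ u → outdegree u * outdegree u ≡ T₁ u + T₁ u + outdegree u
    at u = begin
      outdegree u * outdegree u
        ≡⟨ sum-*-sum (a u) (a u) ⟩
      ∑∑ (λ v w → a u v * a u w)
        ≡⟨ ∑∑-split (λ v w → a u v * a u w) ⟩
      T₁ u + ∑∑ (λ v w → a u v * a u w * a w v) + sum (λ v → a u v * a u v)
        -- Exchanging the names of v and w identifies the second sum with the first.
        ≡⟨ cong₂ (λ x y → T₁ u + x + y)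
             (trans (∑-comm (λ v w → a u v * a u w * a w v))
                    (∑∑-cong (λ w v → cong (_* a w v) (*-comm (a u v) (a u w)))))
             (sum-cong-≗ (a*a≡a u)) ⟩
      T₁ u + T₁ u + outdegree u ∎
    ∑T₁ : sum T₁ ≡ transitive
    ∑T₁ = trans (∑-comm (λ u v → sum (λ w → a u v * a u w * a v w)))
                (∑∑-cong (λ v u → sum-cong-≗ (λ w → swap₂₃ (a u v) (a u w) (a v w))))

  module _ {M : ℕ} (N≡ : N ≡ suc M) where

    degree-sum : ∀ v → outdegree v + indegree v ≡ M
    degree-sum v = suc-injective (trans (degree v) N≡)

    2*arcs : 2 * arcs ≡ suc M * M
    2*arcs = begin
      arcs + (arcs + 0)                      ≡⟨ cong (arcs +_) (+-identityʳ arcs) ⟩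
      arcs + arcs                            ≡⟨ cong (arcs +_) (∑-comm a) ⟩
      arcs + sum indegree                    ≡⟨ sym (∑-distrib-+ outdegree indegree) ⟩
      sum (λ v → outdegree v + indegree v)   ≡⟨ sum-cong-≗ degree-sum ⟩
      sum {N} (λ _ → M)                      ≡⟨ sum-const N M ⟩
      N * M                                  ≡⟨ cong (_* M) N≡ ⟩
      suc M * M                              ∎
      where open ≡-Reasoning

    -- Adding the two counts at each vertex factors out `outdegree + indegree`, which is the
    -- constant `M`.
    triples : transitive + transitive + arcs + (transitive + cyclic) ≡ M * arcs
    triples = begin
      transitive + transitive + arcs + (transitive + cyclic)
        ≡⟨ sym (cong₂ _+_ ∑outdegree² ∑indegree*outdegree) ⟩
      sum (λ v → outdegree v * outdegree v) + sum (λ v → indegree v * outdegree v)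
        ≡⟨ sym (∑-distrib-+ (λ v → outdegree v * outdegree v) (λ v → indegree v * outdegree v)) ⟩
      sum (λ v → outdegree v * outdegree v + indegree v * outdegree v)
        ≡⟨ sum-cong-≗ (λ v → trans (sym (*-distribʳ-+ (outdegree v) (outdegree v) (indegree v)))
                                   (cong (_* outdegree v) (degree-sum v))) ⟩
      sum (λ v → M * outdegree v)
        ≡⟨ sym (*-distribˡ-sum M outdegree) ⟩
      M * arcs ∎
      where open ≡-Reasoning

    -- The in- and outdegree of a vertex sum to `M`, so four times their product is at most `M * M`.
    4*mixed : 4 * (transitive + cyclic) ≤ 2 * arcs * M
    4*mixed = begin
      4 * (transitive + cyclic)                    ≡⟨ cong (4 *_) (sym ∑indegree*outdegree) ⟩
      4 * sum (λ v → indegree v * outdegree v)     ≡⟨ *-distribˡ-sum 4 (λ v → indegree v * outdegree v) ⟩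
      sum (λ v → 4 * (indegree v * outdegree v))   ≤⟨ sum-bound at ⟩
      N * (M * M)                                  ≡⟨ cong (_* (M * M)) N≡ ⟩
      suc M * (M * M)                              ≡⟨ sym (*-assoc (suc M) M M) ⟩
      suc M * M * M                                ≡⟨ cong (_* M) (sym 2*arcs) ⟩
      2 * arcs * M                                 ∎
      where
      open ≤-Reasoning
      at : ∀ v → 4 * (indegree v * outdegree v) ≤ M * M
      at v = ≤-trans (4xy≤[x+y]² (indegree v) (outdegree v))
        (≤-reflexive (cong (λ m → m * m) (trans (+-comm (indegree v) _) (degree-sum v))))

    -- Three times `4*mixed` minus four times `triples` eliminates `transitive` and leaves twice the
    -- claim.
    4*cyclic : 4 * cyclic ≤ arcs * suc N
    -- The term `4 * cyclic + 12 * transitive` stands on both sides in place of a subtraction.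
    4*cyclic = *-cancelˡ-≤ 2 (+-cancelʳ-≤ (4 * cyclic + 12 * transitive) _ _ (begin
      2 * (4 * cyclic) + (4 * cyclic + 12 * transitive)
        ≡⟨ e₁ cyclic transitive ⟩
      3 * (4 * (transitive + cyclic))
        ≤⟨ *-monoʳ-≤ 3 4*mixed ⟩
      3 * (2 * arcs * M)
        ≡⟨ e₂ arcs M ⟩
      2 * (arcs * M) + 4 * (M * arcs)
        ≡⟨ cong (λ x → 2 * (arcs * M) + 4 * x) (sym triples) ⟩
      2 * (arcs * M) + 4 * (transitive + transitive + arcs + (transitive + cyclic))
        ≡⟨ e₃ arcs M cyclic transitive ⟩
      2 * (arcs * suc (suc M)) + (4 * cyclic + 12 * transitive)
        ≡⟨ cong (λ x → 2 * (arcs * suc x) + (4 * cyclic + 12 * transitive)) (sym N≡) ⟩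
      2 * (arcs * suc N) + (4 * cyclic + 12 * transitive) ∎))
      where
      open ≤-Reasoning
      e₁ : ∀ c t → 2 * (4 * c) + (4 * c + 12 * t) ≡ 3 * (4 * (t + c))
      e₁ = solve-∀
      e₂ : ∀ e m → 3 * (2 * e * m) ≡ 2 * (e * m) + 4 * (m * e)
      e₂ = solve-∀
      e₃ : ∀ e m c t → 2 * (e * m) + 4 * (t + t + e + (t + c)) ≡
                       2 * (e * suc (suc m)) + (4 * c + 12 * t)
      e₃ = solve-∀

  cycle? : ∀ u v → Decidable (λ w → T (A v w ∧ A w u))
  cycle? u v w = T? (A v w ∧ A w u)

  cycles : Fin N → Fin N → List (Fin N)
  cycles u v = filter (cycle? u v) (allFin N)

  -- Cyclic triples are grouped by their arc u → v, with `cycles u v` listing the third vertices.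
  cyclic≡∑∑ : cyclic ≡ ∑∑ (λ u v → a u v * length (cycles u v))
  cyclic≡∑∑ = trans (∑-comm (λ v u → sum (λ w → a u v * a v w * a w u))) (∑∑-cong at)
    where
    open ≡-Reasoning
    𝟙-∧ : ∀ b c → 𝟙 b * 𝟙 c ≡ 𝟙 (b ∧ c)
    𝟙-∧ true  c = +-identityʳ (𝟙 c)
    𝟙-∧ false c = refl
    at : ∀ u v → sum (λ w → a u v * a v w * a w u) ≡ a u v * length (cycles u v)
    at u v = begin
      sum (λ w → a u v * a v w * a w u)
        ≡⟨ sum-cong-≗ (λ w → trans (*-assoc (a u v) (a v w) (a w u))
                                   (cong (a u v *_) (𝟙-∧ (A v w) (A w u)))) ⟩
      sum (λ w → a u v * 𝟙 (A v w ∧ A w u))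
        ≡⟨ sym (*-distribˡ-sum (a u v) (λ w → 𝟙 (A v w ∧ A w u))) ⟩
      a u v * sum (λ w → 𝟙 (A v w ∧ A w u))
        ≡⟨ cong (a u v *_) (sym (length-filter-tabulate (cycle? u v) (λ w → w))) ⟩
      a u v * length (cycles u v) ∎

  -- Averaging `4*cyclic` over all arcs: if every arc exceeded the bound there would be no arcs, but
  -- two vertices already force one.
  arc-in-few-cycles : ∀ {M} → N ≡ suc (suc M) →
                      ∃₂ λ u v → Arc u v × 4 * length (cycles u v) ≤ suc N
  arc-in-few-cycles {M} N≡
    with any? (λ u → any? (λ v → T? (A u v) ×-dec (4 * length (cycles u v) ≤? suc N)))
  ... | yes (u , v , uv , few) = u , v , uv , few
  ... | no none = contradiction (2*arcs N≡)
    (<⇒≢ (subst (λ e → 2 * e < suc (suc M) * suc M) (sym arcs≡0) (s≤s z≤n)))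
    where
    open ≤-Reasoning
    many : ∀ u v → a u v * suc (suc N) ≤ a u v * (4 * length (cycles u v))
    many u v with A u v in eq
    ... | false = z≤n
    ... | true  = +-monoˡ-≤ 0 (≰⇒> (λ few → none (u , v , subst T (sym eq) tt , few)))
    too-many : arcs * suc (suc N) ≤ arcs * suc N
    too-many = begin
      arcs * suc (suc N)
        ≡⟨ *-distribʳ-sum (suc (suc N)) outdegree ⟩
      sum (λ u → outdegree u * suc (suc N))
        ≡⟨ sum-cong-≗ (λ u → *-distribʳ-sum (suc (suc N)) (a u)) ⟩
      ∑∑ (λ u v → a u v * suc (suc N))
        ≤⟨ sum-mono (λ u → sum-mono (many u)) ⟩
      ∑∑ (λ u v → a u v * (4 * length (cycles u v)))
        ≡⟨ ∑∑-cong (λ u v → swap₁₂ (a u v) _) ⟩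
      ∑∑ (λ u v → 4 * (a u v * length (cycles u v)))
        ≡⟨ sum-cong-≗ (λ u → sym (*-distribˡ-sum 4 (λ v → a u v * length (cycles u v)))) ⟩
      sum (λ u → 4 * sum (λ v → a u v * length (cycles u v)))
        ≡⟨ sym (*-distribˡ-sum 4 (λ u → sum (λ v → a u v * length (cycles u v)))) ⟩
      4 * ∑∑ (λ u v → a u v * length (cycles u v))
        ≡⟨ cong (4 *_) (sym cyclic≡∑∑) ⟩
      4 * cyclic
        ≤⟨ 4*cyclic N≡ ⟩
      arcs * suc N ∎
      where
      swap₁₂ : ∀ x y → x * (4 * y) ≡ 4 * (x * y)
      swap₁₂ = solve-∀
    -- `too-many` has one more copy of `arcs` on its left than on its right.
    arcs≡0 : arcs ≡ 0
    arcs≡0 = n≤0⇒n≡0 (+-cancelʳ-≤ (arcs * suc N) arcs 0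
      (≤-trans (≤-reflexive (sym (*-suc arcs (suc N)))) too-many))

  -- The order that makes an arc u → v nearly universal

  arrange : ∀ {u v} → Arc u v → ∃ λ D → ∃₂ λ M O →
            allFin N ↭ D ++ u ∷ M ++ v ∷ O ++ cycles u v ×
            All (λ x → Arc x u × Arc x v) D × All (λ x → Arc u x × Arc x v) M ×
            All (λ x → Arc u x × Arc v x) O
  arrange {u} {v} uv = D , M , O , perm , D-arcs , M-arcs , O-arcs
    where
    u≢v : u ≢ v
    u≢v refl = ¬loop uv

    rest : List (Fin N)
    rest = filter (¬? ∘ cycle? u v) (allFin N)

    -- Membership of `u` or `v` in `cycles u v` would require a loop.
    u∈rest : u ∈ rest
    u∈rest = ∈-filter⁺ (¬? ∘ cycle? u v) (∈-allFin u)
                       (¬loop ∘ proj₂ ∘ Equivalence.to (T-∧ {A v u}))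

    without-u : ∃ λ R → rest ↭ u ∷ R
    without-u = ∈⇒↭ u∈rest

    v∈rest : v ∈ rest
    v∈rest = ∈-filter⁺ (¬? ∘ cycle? u v) (∈-allFin v)
                       (¬loop ∘ proj₁ ∘ Equivalence.to (T-∧ {A v v}))

    without-uv : ∃ λ R → rest ↭ u ∷ v ∷ R
    without-uv with without-u
    ... | R₁ , rest↭ with ∈-resp-↭ rest↭ v∈rest
    ...   | here v≡u = contradiction (sym v≡u) u≢v
    ...   | there v∈ with ∈⇒↭ v∈
    ...     | R , R₁↭ = R , ↭-trans rest↭ (prep u R₁↭)

    R : List (Fin N)
    R = proj₁ without-uv

    unique : Unique (u ∷ v ∷ R)
    unique = Unique-resp-↭ (proj₂ without-uv) (AllPairs.filter⁺ _ (allFin⁺ N))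

    R-spec : All (λ x → u ≢ x × v ≢ x × ¬ T (A v x ∧ A x u)) R
    R-spec with unique | All-resp-↭ (proj₂ without-uv) (All.all-filter (¬? ∘ cycle? u v) (allFin N))
    ... | (_ ∷ u≢) ∷ v≢ ∷ _ | _ ∷ _ ∷ ¬cyc = All.zip (u≢ , All.zip (v≢ , ¬cyc))

    into? : ∀ y → Decidable (λ x → Arc x y)
    into? y x = T? (A x y)

    -- `D`, `M`, `O` go before, between and after `u` and `v`. An in-neighbour of `u` reached from
    -- `v` would lie in `cycles u v`, so these three cases suffice.
    D R₂ M O : List (Fin N)
    D  = filter (into? u) R
    R₂ = filter (¬? ∘ into? u) R
    M  = filter (into? v) R₂
    O  = filter (¬? ∘ into? v) R₂

    D-arcs : All (λ x → Arc x u × Arc x v) D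
    D-arcs = All.zipWith
      (λ (xu , _ , v≢x , ¬cyc) → xu , reversed v≢x (λ vx → ¬cyc (Equivalence.from T-∧ (vx , xu))))
      (All.all-filter (into? u) R , All.filter⁺ (into? u) R-spec)

    R₂-spec : All (λ x → Arc u x × v ≢ x) R₂
    R₂-spec = All.zipWith (λ (¬xu , u≢x , v≢x , _) → reversed (u≢x ∘ sym) ¬xu , v≢x)
      (All.all-filter (¬? ∘ into? u) R , All.filter⁺ (¬? ∘ into? u) R-spec)

    M-arcs : All (λ x → Arc u x × Arc x v) M
    M-arcs = All.zipWith (λ (xv , ux , _) → ux , xv)
      (All.all-filter (into? v) R₂ , All.filter⁺ (into? v) R₂-spec)

    O-arcs : All (λ x → Arc u x × Arc v x) O
    O-arcs = All.zipWith (λ (¬xv , ux , v≢x) → ux , reversed (v≢x ∘ sym) ¬xv)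
      (All.all-filter (¬? ∘ into? v) R₂ , All.filter⁺ (¬? ∘ into? v) R₂-spec)

    perm : allFin N ↭ D ++ u ∷ M ++ v ∷ O ++ cycles u v
    perm = ↭-trans (↭-filter-split (cycle? u v) (allFin N))
          (↭-trans (++⁺ˡ (cycles u v) (↭-trans (proj₂ without-uv) (prep u (prep v
             (↭-trans (↭-filter-split (into? u) R) (++⁺ˡ D (↭-filter-split (into? v) R₂)))))))
                   (interleave u v (cycles u v) D M O))

  -- Colour classes in the arranged order.

  module _ {n s u v} {D M O C : List (Fin N)} {c : Fin N → Fin n}
           (uv : Arc u v)
           (D-arcs : All (λ x → Arc x u × Arc x v) D) (M-arcs : All (λ x → Arc u x × Arc x v) M)
           (O-arcs : All (λ x → Arc u x × Arc v x) O) (C-arcs : All (Arc v) C)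
           (C-unique : Unique C) (short : Short s C)
           (proper : Proper A c (D ++ u ∷ M ++ v ∷ O ++ C)) where

    -- Forward arcs join `D`, `M` and `O` to both `u` and `v`, so these parts avoid both colours.
    -- The arcs from `v` to `C` also go forward, which leaves `v` alone; only `C` can share the
    -- colour of `u`.
    u-or-v-class-small : c u ≢ c v × length (class c (c u) (D ++ u ∷ M ++ v ∷ O ++ C)) ≤ s
                                   × length (class c (c v) (D ++ u ∷ M ++ v ∷ O ++ C)) ≤ 1
    u-or-v-class-small with AllPairs-++⁻ D proper
    ... | _ , D-rel , u-rel ∷ rest with AllPairs-++⁻ M rest
    ...   | _ , M-rel , v-rel ∷ rest′ with AllPairs-++⁻ O rest′
    ...     | _ , _ , C-proper = cu≢cv , u-bound , v-bound
      where
      open ≤-Reasoning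
      cu≢cv : c u ≢ c v
      cu≢cv = All.head (All.++⁻ʳ M u-rel) uv
      u? : Decidable (λ x → c x ≡ c u)
      u? x = c x ≟ c u
      v? : Decidable (λ x → c x ≡ c v)
      v? x = c x ≟ c v
      D≢u : All (λ x → c x ≢ c u) D
      D≢u = All.zipWith (λ ((xu , _) , r) → All.head r xu) (D-arcs , D-rel)
      D≢v : All (λ x → c x ≢ c v) D
      D≢v = All.zipWith (λ ((_ , xv) , r) → All.head (All.++⁻ʳ M (All.tail r)) xv) (D-arcs , D-rel)
      M≢u : All (λ x → c x ≢ c u) M
      M≢u = All.zipWith (λ ((ux , _) , r) → r ux ∘ sym) (M-arcs , All.++⁻ˡ M u-rel)
      M≢v : All (λ x → c x ≢ c v) M
      M≢v = All.zipWith (λ ((_ , xv) , r) → All.head r xv) (M-arcs , M-rel)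
      O≢u : All (λ x → c x ≢ c u) O
      O≢u = All.zipWith (λ ((ux , _) , r) → r ux ∘ sym)
                        (O-arcs , All.++⁻ˡ O (All.tail (All.++⁻ʳ M u-rel)))
      OC≢v : All (λ x → c x ≢ c v) (O ++ C)
      OC≢v = All.zipWith (λ (vx , r) → r vx ∘ sym) (All.++⁺ (All.map proj₂ O-arcs) C-arcs , v-rel)
      u-bound : length (filter u? (D ++ u ∷ M ++ v ∷ O ++ C)) ≤ s
      u-bound = begin
        length (filter u? (D ++ u ∷ M ++ v ∷ O ++ C)) ≡⟨ cong length (filter-skip u? _ D≢u) ⟩
        length (filter u? (u ∷ M ++ v ∷ O ++ C))      ≤⟨ length-filter-∷ u? u _ ⟩
        suc (length (filter u? (M ++ v ∷ O ++ C)))    ≡⟨ cong (suc ∘ length) (filter-skip u? _ M≢u) ⟩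
        suc (length (filter u? (v ∷ O ++ C)))         ≡⟨ cong (suc ∘ length) (filter-skip u? (O ++ C) ((cu≢cv ∘ sym) ∷ [])) ⟩
        suc (length (filter u? (O ++ C)))             ≡⟨ cong (suc ∘ length) (filter-skip u? C O≢u) ⟩
        -- The strict bound in `Short` leaves room for `u` itself.
        suc (length (filter u? C))                    ≤⟨ short u? (class-backward (c u) C-proper C-unique) ⟩
        s                                             ∎
      v-bound : length (filter v? (D ++ u ∷ M ++ v ∷ O ++ C)) ≤ 1
      v-bound = begin
        length (filter v? (D ++ u ∷ M ++ v ∷ O ++ C)) ≡⟨ cong length (filter-skip v? _ D≢v) ⟩
        length (filter v? (u ∷ M ++ v ∷ O ++ C))      ≡⟨ cong length (filter-skip v? (M ++ v ∷ O ++ C) (cu≢cv ∷ [])) ⟩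
        length (filter v? (M ++ v ∷ O ++ C))          ≡⟨ cong length (filter-skip v? _ M≢v) ⟩
        length (filter v? (v ∷ O ++ C))               ≤⟨ length-filter-∷ v? v _ ⟩
        suc (length (filter v? (O ++ C)))             ≡⟨ cong (suc ∘ length) (filter-none v? OC≢v) ⟩
        1                                             ∎

  -- Every pair of a chain is a forward arc, so colour classes are singletons and `n` colours cannot
  -- serve `suc n` vertices.
  chain⇒fGt : ∀ {n L} → Unique L → HasChain (suc n) L → fGt A n
  chain⇒fGt {n} {L} unique (X , R , L↭ , chain , len) = order⇒fGt A X
    (proj₁ (AllPairs-++⁻ X (Unique-resp-↭ L↭ unique))) λ c proper → <-irrefl refl (begin-strict
      n                              <⟨ ≤-reflexive (sym len) ⟩
      length X                       ≡⟨ length-classes c X ⟩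
      sum (λ k → length (class c k X)) ≤⟨ sum-bound (λ k → class≤1 c k proper) ⟩
      n * 1                          ≡⟨ *-identityʳ n ⟩
      n                              ∎)
    where
    open ≤-Reasoning
    class≤1 : ∀ (c : Fin N → Fin n) k → Proper A c X → length (class c k X) ≤ 1
    class≤1 c k proper = length≤1 {Q = λ _ _ → ⊥} (λ _ ())
      (AllPairs.filter⁺ _ chain)
      (AllPairs.map (λ (cx , cy , xy , xy⇒) → xy⇒ xy (trans cx (sym cy)))
        (AllPairs-restrict (All.all-filter _ X) (AllPairs.filter⁺ _ (AllPairs.zip (chain , proper)))))

  -- A chain of k + 2 vertices suffices alone. Otherwise classes have at most k + 1 vertices, those
  -- of `u` and `v` at most `s` and 1, so for k ≥ 1 at most s + 1 + (k - 1)(k + 1) = s + k² vertices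
  -- can be coloured.
  tournament⇒fGt : ∀ {u v} k s → Arc u v → 2 * length (cycles u v) < s * suc s → s + k * k < N →
                   fGt A (suc k)
  tournament⇒fGt {u} {v} k s uv small large with hasChain? (suc (suc k)) (allFin N)
  ... | yes chain = chain⇒fGt (allFin⁺ N) chain
  ... | no ¬chain with arrange uv | reorder s (cycles u v) small
  ...   | D , M , O , perm , D-arcs , M-arcs , O-arcs | C , C↭ , short =
    order⇒fGt A L L-unique impossible
    where
    L : List (Fin N)
    L = D ++ u ∷ M ++ v ∷ O ++ C

    all↭L : allFin N ↭ L
    all↭L = ↭-trans perm (++⁺ˡ D (prep u (++⁺ˡ M (prep v (++⁺ˡ O C↭)))))

    L-unique : Unique L
    L-unique = Unique-resp-↭ all↭L (allFin⁺ N)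

    C-unique : Unique C
    C-unique = Unique-resp-↭ C↭ (AllPairs.filter⁺ _ (allFin⁺ N))

    C-arcs : All (Arc v) C
    C-arcs = All-resp-↭ C↭ (All.map (proj₁ ∘ Equivalence.to T-∧) (All.all-filter (cycle? u v) (allFin N)))

    -- A larger class, reversed, would contain the excluded chain.
    class≤ : ∀ {c : Fin N → Fin (suc k)} → Proper A c L → ∀ i → length (class c i L) ≤ suc k
    class≤ proper i = ≮⇒≥ λ long → ¬chain
      (let X , R , L↭ , rest = backward⇒chain _ (class-backward i proper L-unique) long
       in X , R , ↭-trans all↭L L↭ , rest)

    impossible : ∀ (c : Fin N → Fin (suc k)) → ¬ Proper A c L
    impossible c proper
      with u-or-v-class-small uv D-arcs M-arcs O-arcs C-arcs C-unique short proper
    ... | cu≢cv , u-class , v-class = <⇒≱ large (begin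
      N                                ≡⟨ sym (length-tabulate (λ (i : Fin N) → i)) ⟩
      length (allFin N)                ≡⟨ ↭-length all↭L ⟩
      length L                         ≡⟨ length-classes c L ⟩
      sum (λ i → length (class c i L)) ≤⟨ bound k (c u) (c v) cu≢cv u-class v-class (class≤ proper) ⟩
      s + k * k                        ∎)
      where
      open ≤-Reasoning
      square : ∀ j → 1 + j * suc (suc j) ≡ suc j * suc j
      square = solve-∀
      bound : ∀ k {f : Fin (suc k) → ℕ} i₁ i₂ → i₁ ≢ i₂ → f i₁ ≤ s → f i₂ ≤ 1 →
              (∀ i → f i ≤ suc k) → sum f ≤ s + k * k
      -- A single colour cannot separate `u` from `v`.
      bound zero    zero zero i₁≢i₂ _ _ _ = contradiction refl i₁≢i₂
      bound (suc j) {f} i₁ i₂ i₁≢i₂ f₁ f₂ f≤ = subst (λ x → sum f ≤ s + x) (square j)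
        (sum-bound₂ {j} i₁ i₂ i₁≢i₂ f₁ f₂ f≤)

-- The numerical bound.

-- d = ⌊√(x/2)⌋
half-sqrt : ∀ x → ∃ λ d → 2 * (d * d) ≤ x × x < 2 * (suc d * suc d)
half-sqrt zero    = 0 , z≤n , s≤s z≤n
half-sqrt (suc x) with half-sqrt x
... | d , lower , upper with 2 * (suc d * suc d) ≤? suc x
...   | no  ≰x = d , m≤n⇒m≤1+n lower , ≰⇒> ≰x
...   | yes ≤x = suc d , ≤x , ≤-trans (s≤s upper) (*-monoʳ-< 2 (*-mono-< (n<1+n (suc d)) (n<1+n (suc d))))

theorem1p3 : ∀ (n : ℕ) → 1 ≤ n → Σ ℕ λ m → BelowBound n m × GProperty n m
theorem1p3 (suc k) _ with half-sqrt (suc k * suc k)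
-- With n = k + 1, k² + 1 is n² - 2n + 2, so the witness exceeds it by `d`, the integer part of
-- n/√2.
... | d , lower , upper = d + suc (k * k) , inj₂ below , large-tournament
  where
  excess : ℤ
  excess = pos (d + suc (k * k)) ℤ.+ pos (2 * suc k) ℤ.- pos (suc k * suc k) ℤ.- pos 2

  excess≡d : excess ≡ pos d
  excess≡d = trans (cong (λ x → pos x ℤ.- pos (suc k * suc k) ℤ.- pos 2) (expand d k))
                   (cancel (pos d) (pos (suc k * suc k)) (pos 2))
    where
    expand : ∀ d k → d + suc (k * k) + 2 * suc k ≡ d + suc k * suc k + 2
    expand = solve-∀
    cancel : ∀ (x y z : ℤ) → x ℤ.+ y ℤ.+ z ℤ.- y ℤ.- z ≡ x
    cancel = ℤ.solve-∀

  below : pos 2 ℤ.* (excess ℤ.* excess) ℤ.≤ pos (suc k * suc k)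
  below = subst (λ x → pos 2 ℤ.* (x ℤ.* x) ℤ.≤ pos (suc k * suc k)) (sym excess≡d)
    (subst (ℤ._≤ pos (suc k * suc k))
      (trans (ℤ.pos-* 2 (d * d)) (cong (pos 2 ℤ.*_) (ℤ.pos-* d d))) (+≤+ lower))

  large-tournament : GProperty (suc k) (d + suc (k * k))
  large-tournament N m<N A tournament with m≤n⇒∃[o]m+o≡n m<N
  ... | o , refl with arc-in-few-cycles A tournament (size d k o)
    where
    size : ∀ d k o → suc (d + suc (k * k)) + o ≡ suc (suc (d + k * k + o))
    size = solve-∀
  ...   | u , v , uv , few =
    tournament⇒fGt A tournament k s uv (*-cancelˡ-< 2 _ _ few′) (≤-reflexive (N≡ d k o))
    where
    open ≤-Reasoning
    -- The largest `s` with `s + k * k < N`. It grows with the surplus `o`, so larger tournaments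
    -- need no separate reduction.
    s = suc d + o
    c = length (cycles A tournament u v)
    N≡ : ∀ d k o → suc (suc d + o + k * k) ≡ suc (d + suc (k * k)) + o
    N≡ = solve-∀
    2s² : ∀ s → s + (s + 2 * (s * s)) ≡ 2 * (s * suc s)
    2s² = solve-∀
    4c : ∀ c → 2 * (2 * c) ≡ 4 * c
    4c = solve-∀
    N≤ : ∀ s k → suc (suc (s + k * k)) + 2 * k ≡ s + suc k * suc k + 1
    N≤ = solve-∀
    few′ : 2 * (2 * c) < 2 * (s * suc s)
    -- The key estimate is n² + 1 ≤ 2(d + 1)² ≤ 2s², from `upper`; the spare `s` makes the final
    -- inequality strict.
    few′ = begin-strict
      2 * (2 * c)                     ≡⟨ 4c c ⟩
      4 * c                           ≤⟨ few ⟩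
      suc N                           ≡⟨ cong suc (sym (N≡ d k o)) ⟩
      suc (suc (s + k * k))           ≤⟨ m≤m+n _ (2 * k) ⟩
      suc (suc (s + k * k)) + 2 * k   ≡⟨ N≤ s k ⟩
      s + suc k * suc k + 1           ≡⟨ trans (+-assoc s _ 1) (cong (_+_ s) (+-comm _ 1)) ⟩
      s + suc (suc k * suc k)         ≤⟨ +-monoʳ-≤ s upper ⟩
      s + 2 * (suc d * suc d)         ≤⟨ +-monoʳ-≤ s (*-monoʳ-≤ 2 (*-mono-≤ (m≤m+n (suc d) o) (m≤m+n (suc d) o))) ⟩
      s + 2 * (s * s)                 <⟨ +-monoˡ-≤ (s + 2 * (s * s)) (s≤s (z≤n {d + o})) ⟩
      s + (s + 2 * (s * s))           ≡⟨ 2s² s ⟩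
      2 * (s * suc s)                 ∎
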